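{- Let $\mathcal{B}$ be the (infinite) set of all full binary trees, and let $$K(x,q) := \sum_{T\in\mathcal{B}} x^{V(T)} q^{JD(T)},$$ a formal power series in $x$ whose coefficients are polynomials in $q$. Then $$ K(x,q) = \frac{2 q}{\sqrt{1-4 q x}-1+2 q}, $$ where the square root denotes the formal power series square root with constant term $1$, and the identity holds in the ring $\mathbb{Q}(q)[[x]]$.
   Context: A full binary tree is an unlabeled ordered tree defined recursively: it is either the single-vertex tree, denoted $\cdot$, or a pair $T=[T_L,T_R]$ where $T_L$ (left subtree) and $T_R$ (right subtree) are full binary trees. The number of internal vertices $V(T)$ is defined by $V(\cdot)=0$, $V([T_L,T_R])=V(T_L)+V(T_R)+1$. The depth of the rightmost leaf $D(T)$ is defined by $D(\cdot)=0$, $D([T_L,T_R])=1+D(T_R)$. The sum of jump distances $JD(T)$ is defined by $JD(\cdot)=0$, $JD([T_L,T_R])=JD(T_L)+JD(T_R)+D(T_L)$. -}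

module Defs where

open import Algebra.Bundles using (CommutativeRing; RawRing)
open import Algebra.Definitions using (AlmostLeftCancellative)
open import Algebra.Structures using (IsCommutativeRing)
open import Algebra.Morphism.Structures using (IsRingMonomorphism)
import Algebra.Construct.Pointwise as Pointwise
import Algebra.Morphism.RingMonomorphism as RingMonomorphism
import Algebra.Properties.CommutativeMonoid.Sum as Sum
import Algebra.Properties.Monoid.Mult as Mult
import Algebra.Properties.Ring as RingProperties
import Algebra.Properties.Semiring.Exp as Exp
import Algebra.Solver.Ring.NaturalCoefficients.Default as Solver
open import Data.Empty using (⊥-elim)
open import Data.Fin.Base using (toℕ)
open import Data.List.Base using (List; []; _∷_; map; foldr; concatMap; cartesianProductWith; upTo)
open import Data.List.Membership.Propositional using (_∈_; find; lose)
open import Data.List.Membership.Propositional.Properties using (∈-concatMap⁺; ∈-concatMap⁻; ∈-cartesianProductWith⁺; ∈-cartesianProductWith⁻; ∈-upTo⁺; ∈-upTo⁻)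
open import Data.List.Relation.Unary.All using ([]; _∷_)
import Data.List.Relation.Unary.All.Properties as All
import Data.List.Relation.Unary.All as All
open import Data.List.Relation.Unary.AllPairs using ([]; _∷_)
import Data.List.Relation.Unary.AllPairs as AllPairs
import Data.List.Relation.Unary.AllPairs.Properties as AllPairs
open import Data.List.Relation.Unary.Any using (here)
open import Data.List.Relation.Unary.Unique.Propositional using (Unique)
open import Data.List.Relation.Unary.Unique.Propositional.Properties using (concat⁺; cartesianProductWith⁺; upTo⁺)
open import Data.Nat.Base as ℕ using (ℕ; zero; suc; _∸_; z≤n; s≤s)
import Data.Nat.Properties as ℕ
open import Data.Product.Base using (∃; _,_; proj₁; proj₂)
import Data.Product.Base as Product
open import Data.Rational.Base as ℚ using (ℚ; 0ℚ; 1ℚ)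
import Data.Rational.Properties as ℚ
open import Level using (_⊔_)
open import Relation.Binary.Definitions using (Decidable)
open import Relation.Binary.Structures using (IsEquivalence)
open import Relation.Binary.PropositionalEquality as ≡ using (_≡_)
import Relation.Binary.Reasoning.Setoid as SetoidReasoning
open import Relation.Nullary using (¬_; yes; no)

data Tree : Set where
  ·     : Tree
  [_,_] : (L R : Tree) → Tree

V : Tree → ℕ
V ·         = 0
V [ L , R ] = V L ℕ.+ V R ℕ.+ 1

D : Tree → ℕ
D ·         = 0
D [ L , R ] = 1 ℕ.+ D R

JD : Tree → ℕ
JD ·         = 0
JD [ L , R ] = JD L ℕ.+ JD R ℕ.+ D L

-- The first argument only bounds the recursion: the result is the list
-- of all trees with n internal vertices as soon as n ≤ fuel.
enumerate : (fuel n : ℕ) → List Tree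
enumerate _       zero    = · ∷ []
enumerate zero    (suc _) = []
enumerate (suc k) (suc n) =
  concatMap (λ i → cartesianProductWith [_,_] (enumerate k i) (enumerate k (n ∸ i)))
            (upTo (suc n))

treesOfSize : ℕ → List Tree
treesOfSize n = enumerate n n

private
  enumerate-sound : ∀ k n {T} → T ∈ enumerate k n → V T ≡ n
  enumerate-sound zero    zero    (here ≡.refl) = ≡.refl
  enumerate-sound (suc k) zero    (here ≡.refl) = ≡.refl
  enumerate-sound (suc k) (suc n) T∈
    with i , i∈ , T∈ᵢ ← find (∈-concatMap⁻ _ {xs = upTo (suc n)} T∈)
    with L , R , L∈ , R∈ , ≡.refl ← ∈-cartesianProductWith⁻ [_,_] (enumerate k i) _ T∈ᵢ
    rewrite enumerate-sound k i L∈ | enumerate-sound k (n ∸ i) R∈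
    = ≡.trans (ℕ.+-comm _ 1) (≡.cong suc (ℕ.m+[n∸m]≡n (ℕ.≤-pred (∈-upTo⁻ i∈))))

  enumerate-complete : ∀ k T → V T ℕ.≤ k → T ∈ enumerate k (V T)
  enumerate-complete zero    ·         _  = here ≡.refl
  enumerate-complete (suc k) ·         _  = here ≡.refl
  enumerate-complete zero    [ L , R ] V≤ rewrite ℕ.+-comm (V L ℕ.+ V R) 1 = ⊥-elim (ℕ.n≮0 V≤)
  enumerate-complete (suc k) [ L , R ] V≤ rewrite ℕ.+-comm (V L ℕ.+ V R) 1 =
    ∈-concatMap⁺ _ (lose (∈-upTo⁺ (s≤s (ℕ.m≤m+n (V L) (V R))))
      (∈-cartesianProductWith⁺ [_,_]
        (enumerate-complete k L (ℕ.m+n≤o⇒m≤o (V L) (ℕ.≤-pred V≤)))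
        (≡.subst (λ j → R ∈ enumerate k j) (≡.sym (ℕ.m+n∸m≡n (V L) (V R)))
          (enumerate-complete k R (ℕ.m+n≤o⇒n≤o (V L) (ℕ.≤-pred V≤))))))

  enumerate-unique : ∀ k n → Unique (enumerate k n)
  enumerate-unique zero    zero    = [] ∷ []
  enumerate-unique (suc k) zero    = [] ∷ []
  enumerate-unique zero    (suc n) = []
  enumerate-unique (suc k) (suc n) =
    concat⁺ (All.map⁺ (All.universal block-unique (upTo (suc n))))
            (AllPairs.map⁺ (AllPairs.map disjoint (upTo⁺ (suc n))))
    where
    block : ℕ → List Tree
    block i = cartesianProductWith [_,_] (enumerate k i) (enumerate k (n ∸ i))

    block-unique : ∀ i → Unique (block i)
    block-unique i = cartesianProductWith⁺ [_,_] (λ { ≡.refl → ≡.refl , ≡.refl })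
                       (enumerate-unique k i) (enumerate-unique k (n ∸ i))

    left-size : ∀ i {L R} → [ L , R ] ∈ block i → V L ≡ i
    left-size i T∈ with _ , _ , L∈ , _ , ≡.refl ← ∈-cartesianProductWith⁻ [_,_] (enumerate k i) _ T∈ =
      enumerate-sound k i L∈

    disjoint : ∀ {i j} → ¬ i ≡ j → ∀ {T} → ¬ (T ∈ block i Product.× T ∈ block j)
    disjoint {i} {j} i≢j (T∈ᵢ , T∈ⱼ)
      with _ , _ , _ , _ , ≡.refl ← ∈-cartesianProductWith⁻ [_,_] (enumerate k i) _ T∈ᵢ =
      i≢j (≡.trans (≡.sym (left-size i T∈ᵢ)) (left-size j T∈ⱼ))

∈-treesOfSize⁻ : ∀ n {T} → T ∈ treesOfSize n → V T ≡ n
∈-treesOfSize⁻ n = enumerate-sound n n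

∈-treesOfSize⁺ : ∀ T → T ∈ treesOfSize (V T)
∈-treesOfSize⁺ T = enumerate-complete (V T) T ℕ.≤-refl

treesOfSize-unique : ∀ n → Unique (treesOfSize n)
treesOfSize-unique n = enumerate-unique n n

module PowerSeries {c ℓ} (R : CommutativeRing c ℓ) where

  open CommutativeRing R
  open Sum +-commutativeMonoid using (sum)
  open RingProperties ring
  open SetoidReasoning setoid
  open Solver commutativeSemiring using (solve; _:=_; _:+_; _:*_)

  Series : Set c
  Series = ℕ → Carrier

  infix  4 _≋_
  infixl 7 _⊛_
  infixl 6 _⊕_

  _≋_ : Series → Series → Set ℓ
  f ≋ g = ∀ n → f n ≈ g n

  _⊕_ : Series → Series → Series
  (f ⊕ g) n = f n + g n

  ⊖_ : Series → Series
  (⊖ f) n = - f n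

  _⊛_ : Series → Series → Series
  (f ⊛ g) n = sum {suc n} λ i → f (toℕ i) * g (n ∸ toℕ i)

  constant : Carrier → Series
  constant a zero    = a
  constant a (suc n) = 0#

  𝟘 𝟙 : Series
  𝟘 n = 0#
  𝟙   = constant 1#

  X : Series
  X zero    = 0#
  X (suc n) = 𝟙 n

  tail : Series → Series
  tail f n = f (suc n)

  ⊛-cong-≤ : ∀ n {f f′ g g′} → (∀ {m} → m ℕ.≤ n → f m ≈ f′ m) →
             (∀ {m} → m ℕ.≤ n → g m ≈ g′ m) → (f ⊛ g) n ≈ (f′ ⊛ g′) n
  ⊛-cong-≤ zero    f≈ g≈ = +-congʳ (*-cong (f≈ z≤n) (g≈ z≤n))
  ⊛-cong-≤ (suc n) f≈ g≈ = +-cong (*-cong (f≈ z≤n) (g≈ ℕ.≤-refl))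
    (⊛-cong-≤ n (λ m≤n → f≈ (s≤s m≤n)) (λ m≤n → g≈ (ℕ.m≤n⇒m≤1+n m≤n)))

  ⊛-cong : ∀ {f f′ g g′} → f ≋ f′ → g ≋ g′ → f ⊛ g ≋ f′ ⊛ g′
  ⊛-cong f≈ g≈ n = ⊛-cong-≤ n (λ {m} _ → f≈ m) (λ {m} _ → g≈ m)

  ⊛-suc : ∀ f g n → (f ⊛ g) (suc n) ≈ (f ⊛ tail g) n + f (suc n) * g 0
  ⊛-suc f g zero    = solve 3 (λ a b z → a :+ (b :+ z) := (a :+ z) :+ b) refl _ _ _
  ⊛-suc f g (suc n) = begin
    f 0 * g (2 ℕ.+ n) + (tail f ⊛ g) (suc n)                                ≈⟨ +-congˡ (⊛-suc (tail f) g n) ⟩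
    f 0 * g (2 ℕ.+ n) + ((tail f ⊛ tail g) n + f (2 ℕ.+ n) * g 0)           ≈⟨ +-assoc _ _ _ ⟨
    f 0 * g (2 ℕ.+ n) + (tail f ⊛ tail g) n + f (2 ℕ.+ n) * g 0             ∎

  ⊛-zeroˡ : ∀ {f} → f ≋ 𝟘 → ∀ g → f ⊛ g ≋ 𝟘
  ⊛-zeroˡ f≈0 g zero    = trans (+-congʳ (trans (*-congʳ (f≈0 0)) (zeroˡ _))) (+-identityˡ 0#)
  ⊛-zeroˡ f≈0 g (suc n) = trans (+-cong (trans (*-congʳ (f≈0 0)) (zeroˡ _)) (⊛-zeroˡ (λ m → f≈0 (suc m)) g n))
                                (+-identityˡ 0#)

  ⊛-comm : ∀ f g → f ⊛ g ≋ g ⊛ f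
  ⊛-comm f g zero    = +-congʳ (*-comm _ _)
  ⊛-comm f g (suc n) = begin
    f 0 * g (suc n) + (tail f ⊛ g) n ≈⟨ +-cong (*-comm _ _) (⊛-comm (tail f) g n) ⟩
    g (suc n) * f 0 + (g ⊛ tail f) n ≈⟨ +-comm _ _ ⟩
    (g ⊛ tail f) n + g (suc n) * f 0 ≈⟨ ⊛-suc g f n ⟨
    (g ⊛ f) (suc n)                  ∎

  ⊛-distribʳ : ∀ h f g → (f ⊕ g) ⊛ h ≋ f ⊛ h ⊕ g ⊛ h
  ⊛-distribʳ h f g zero    = begin
    (f 0 + g 0) * h 0 + 0#                  ≈⟨ +-identityʳ _ ⟩
    (f 0 + g 0) * h 0                       ≈⟨ distribʳ _ _ _ ⟩
    f 0 * h 0 + g 0 * h 0                   ≈⟨ +-cong (+-identityʳ _) (+-identityʳ _) ⟨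
    (f 0 * h 0 + 0#) + (g 0 * h 0 + 0#)     ∎
  ⊛-distribʳ h f g (suc n) = trans (+-congˡ (⊛-distribʳ h (tail f) (tail g) n))
    (solve 5 (λ a b c d e → (a :+ b) :* c :+ (d :+ e) := (a :* c :+ d) :+ (b :* c :+ e)) refl _ _ _ _ _)

  ⊛-scale : ∀ a f g n → ((λ m → a * f m) ⊛ g) n ≈ a * (f ⊛ g) n
  ⊛-scale a f g zero    = begin
    a * f 0 * g 0 + 0#   ≈⟨ +-identityʳ _ ⟩
    a * f 0 * g 0        ≈⟨ *-assoc _ _ _ ⟩
    a * (f 0 * g 0)      ≈⟨ *-congˡ (+-identityʳ _) ⟨
    a * (f 0 * g 0 + 0#) ∎
  ⊛-scale a f g (suc n) = trans (+-congˡ (⊛-scale a (tail f) g n))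
    (solve 4 (λ a b c d → a :* b :* c :+ a :* d := a :* (b :* c :+ d)) refl _ _ _ _)

  ⊛-assoc : ∀ f g h → (f ⊛ g) ⊛ h ≋ f ⊛ (g ⊛ h)
  ⊛-assoc f g h zero    = +-congʳ (begin
    (f 0 * g 0 + 0#) * h 0 ≈⟨ *-congʳ (+-identityʳ _) ⟩
    f 0 * g 0 * h 0        ≈⟨ *-assoc _ _ _ ⟩
    f 0 * (g 0 * h 0)      ≈⟨ *-congˡ (+-identityʳ _) ⟨
    f 0 * (g 0 * h 0 + 0#) ∎)
  ⊛-assoc f g h (suc n) = begin
    (f 0 * g 0 + 0#) * h (suc n) + (((λ m → f 0 * tail g m) ⊕ tail f ⊛ g) ⊛ h) n
      ≈⟨ +-cong (*-congʳ (+-identityʳ _)) (⊛-distribʳ h (λ m → f 0 * tail g m) (tail f ⊛ g) n) ⟩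
    f 0 * g 0 * h (suc n) + (((λ m → f 0 * tail g m) ⊛ h) n + ((tail f ⊛ g) ⊛ h) n)
      ≈⟨ +-congˡ (+-cong (⊛-scale (f 0) (tail g) h n) (⊛-assoc (tail f) g h n)) ⟩
    f 0 * g 0 * h (suc n) + (f 0 * (tail g ⊛ h) n + (tail f ⊛ (g ⊛ h)) n)
      ≈⟨ solve 5 (λ a b c d e → a :* b :* c :+ (a :* d :+ e) := a :* (b :* c :+ d) :+ e) refl _ _ _ _ _ ⟩
    f 0 * (g 0 * h (suc n) + (tail g ⊛ h) n) + (tail f ⊛ (g ⊛ h)) n ∎

  ⊛-identityˡ : ∀ f → 𝟙 ⊛ f ≋ f
  ⊛-identityˡ f zero    = trans (+-identityʳ _) (*-identityˡ _)
  ⊛-identityˡ f (suc n) = trans (+-cong (*-identityˡ _) (⊛-zeroˡ (λ _ → refl) f n)) (+-identityʳ _)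

  series-isCommutativeRing : IsCommutativeRing _≋_ _⊕_ _⊛_ ⊖_ 𝟘 𝟙
  series-isCommutativeRing = record
    { isRing = record
      { +-isAbelianGroup = Pointwise.isAbelianGroup ℕ +-isAbelianGroup
      ; *-cong           = ⊛-cong
      ; *-assoc          = ⊛-assoc
      ; *-identity       = ⊛-identityˡ , λ f n → trans (⊛-comm f 𝟙 n) (⊛-identityˡ f n)
      ; distrib          = (λ f g h n → trans (⊛-comm f (g ⊕ h) n) (trans (⊛-distribʳ f g h n)
                              (+-cong (⊛-comm g f n) (⊛-comm h f n))))
                         , ⊛-distribʳ
      }
    ; *-comm = ⊛-comm
    }

  seriesRing : CommutativeRing c ℓ
  seriesRing = record { isCommutativeRing = series-isCommutativeRing }

  -- fix F is the solution of f ≋ F f for operators F such that the n-th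
  -- coefficient of F f depends only on the coefficients of f below n.

  approximation : (Series → Series) → ℕ → Series
  approximation F zero    = 𝟘
  approximation F (suc n) = F (approximation F n)

  fix : (Series → Series) → Series
  fix F n = approximation F (suc n) n

  Guarded : (Series → Series) → Set (c ⊔ ℓ)
  Guarded F = ∀ {f g} n → (∀ {m} → m ℕ.< n → f m ≈ g m) → F f n ≈ F g n

  private
    module _ {F} (guarded : Guarded F) where

      stable : ∀ m k {n} → n ℕ.< m → approximation F m n ≈ approximation F (m ℕ.+ k) n
      stable (suc m) k (s≤s n≤m) = guarded _ (λ l<n → stable m k (ℕ.<-≤-trans l<n n≤m))

  fix-solves : ∀ {F} → Guarded F → fix F ≋ F (fix F)
  fix-solves {F} guarded n = guarded n below
    where
    below : ∀ {m} → m ℕ.< n → approximation F n m ≈ fix F m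
    below {m} m<n with k , ≡.refl ← ℕ.m≤n⇒∃[o]m+o≡n m<n = sym (stable guarded (suc m) k ℕ.≤-refl)

  fix-unique : ∀ {F} → Guarded F → ∀ {f} → f ≋ F f → f ≋ fix F
  fix-unique {F} guarded {f} f≈Ff n = agree (suc n) ℕ.≤-refl
    where
    agree : ∀ n {m} → m ℕ.< n → f m ≈ approximation F n m
    agree (suc n) {m} (s≤s m≤n) = trans (f≈Ff m) (guarded m (λ l<m → agree n (ℕ.<-≤-trans l<m m≤n)))

  Unit : Carrier → Set (c ⊔ ℓ)
  Unit a = ∃ λ b → a * b ≈ 1#

  private
    inverseStep : Series → Carrier → Series → Series
    inverseStep f b g zero    = b
    inverseStep f b g (suc n) = b * - (tail f ⊛ g) n

    inverseStep-guarded : ∀ f b → Guarded (inverseStep f b)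
    inverseStep-guarded f b zero    g≈ = refl
    inverseStep-guarded f b (suc n) g≈ =
      *-congˡ (-‿cong (⊛-cong-≤ n {f = tail f} (λ _ → refl) (λ m≤n → g≈ (s≤s m≤n))))

  inverse : (f : Series) → Unit (f 0) → Series
  inverse f (b , _) = fix (inverseStep f b)

  ⊛-inverse : ∀ f (u : Unit (f 0)) → f ⊛ inverse f u ≋ 𝟙
  ⊛-inverse f (b , fb≈1) zero    = trans (+-identityʳ _) fb≈1
  ⊛-inverse f (b , fb≈1) (suc n) = begin
    f 0 * g (suc n) + (tail f ⊛ g) n                    ≈⟨ +-congʳ (*-congˡ (fix-solves (inverseStep-guarded f b) (suc n))) ⟩
    f 0 * (b * - (tail f ⊛ g) n) + (tail f ⊛ g) n       ≈⟨ +-congʳ (*-assoc _ _ _) ⟨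
    f 0 * b * - (tail f ⊛ g) n + (tail f ⊛ g) n         ≈⟨ +-congʳ (trans (*-congʳ fb≈1) (*-identityˡ _)) ⟩
    - (tail f ⊛ g) n + (tail f ⊛ g) n                   ≈⟨ -‿inverseˡ _ ⟩
    0#                                                  ∎
    where g = inverse f (b , fb≈1)

  infixl 7 _/_⟨_⟩

  _/_⟨_⟩ : Series → (g : Series) → Unit (g 0) → Series
  f / g ⟨ u ⟩ = f ⊛ inverse g u

  module SquareRoot (2-unit : Unit (1# + 1#)) where

    private
      ½ : Carrier
      ½ = proj₁ 2-unit

      halve : ∀ a → ½ * a + ½ * a ≈ a
      halve a = begin
        ½ * a + ½ * a               ≈⟨ +-cong (*-identityˡ _) (*-identityˡ _) ⟨
        1# * (½ * a) + 1# * (½ * a) ≈⟨ distribʳ _ _ _ ⟨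
        (1# + 1#) * (½ * a)         ≈⟨ *-assoc _ _ _ ⟨
        (1# + 1#) * ½ * a           ≈⟨ *-congʳ (proj₂ 2-unit) ⟩
        1# * a                      ≈⟨ *-identityˡ a ⟩
        a                           ∎

      -- (1 + x g)² = f amounts to 2 g + x g² = (f - 1) / x.
      rootStep : Series → Series → Series
      rootStep f g zero    = ½ * f 1
      rootStep f g (suc n) = ½ * (f (2 ℕ.+ n) - (g ⊛ g) n)

      rootStep-guarded : ∀ f → Guarded (rootStep f)
      rootStep-guarded f zero    g≈ = refl
      rootStep-guarded f (suc n) g≈ = *-congˡ (+-congˡ (-‿cong
        (⊛-cong-≤ n (λ m≤n → g≈ (s≤s m≤n)) (λ m≤n → g≈ (s≤s m≤n)))))

      square-suc-suc : ∀ s → s 0 ≈ 1# → ∀ n →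
        (s ⊛ s) (2 ℕ.+ n) ≈ s (2 ℕ.+ n) + s (2 ℕ.+ n) + (tail s ⊛ tail s) n
      square-suc-suc s s₀ n = begin
        s 0 * s (2 ℕ.+ n) + (tail s ⊛ s) (suc n)                            ≈⟨ +-cong (trans (*-congʳ s₀) (*-identityˡ _)) (⊛-suc (tail s) s n) ⟩
        s (2 ℕ.+ n) + ((tail s ⊛ tail s) n + s (2 ℕ.+ n) * s 0)             ≈⟨ +-congˡ (+-congˡ (trans (*-congˡ s₀) (*-identityʳ _))) ⟩
        s (2 ℕ.+ n) + ((tail s ⊛ tail s) n + s (2 ℕ.+ n))                   ≈⟨ solve 2 (λ a b → a :+ (b :+ a) := a :+ a :+ b) refl _ _ ⟩
        s (2 ℕ.+ n) + s (2 ℕ.+ n) + (tail s ⊛ tail s) n                     ∎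

      square-1 : ∀ s → s 0 ≈ 1# → (s ⊛ s) 1 ≈ s 1 + s 1
      square-1 s s₀ = +-cong (trans (*-congʳ s₀) (*-identityˡ _))
                             (trans (+-identityʳ _) (trans (*-congˡ s₀) (*-identityʳ _)))

    -- By sqrt-square and sqrt-unique, the only square root of f with
    -- constant term 1.
    sqrt : (f : Series) → f 0 ≈ 1# → Series
    sqrt f _ zero    = 1#
    sqrt f _ (suc n) = fix (rootStep f) n

    sqrt-square : ∀ f (f₀ : f 0 ≈ 1#) → sqrt f f₀ ⊛ sqrt f f₀ ≋ f
    sqrt-square f f₀ zero          = trans (+-identityʳ _) (trans (*-identityˡ _) (sym f₀))
    sqrt-square f f₀ (suc zero)    = trans (square-1 (sqrt f f₀) refl) (halve (f 1))
    sqrt-square f f₀ (suc (suc n)) = begin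
      (s ⊛ s) (2 ℕ.+ n)                                          ≈⟨ square-suc-suc s refl n ⟩
      g (suc n) + g (suc n) + (g ⊛ g) n                          ≈⟨ +-congʳ (+-cong g≈ g≈) ⟩
      ½ * d + ½ * d + (g ⊛ g) n                                  ≈⟨ +-congʳ (halve d) ⟩
      f (2 ℕ.+ n) - (g ⊛ g) n + (g ⊛ g) n                        ≈⟨ +-assoc _ _ _ ⟩
      f (2 ℕ.+ n) + (- (g ⊛ g) n + (g ⊛ g) n)                    ≈⟨ +-congˡ (-‿inverseˡ _) ⟩
      f (2 ℕ.+ n) + 0#                                           ≈⟨ +-identityʳ _ ⟩
      f (2 ℕ.+ n)                                                ∎
      where
      s = sqrt f f₀
      g = tail s
      d = f (2 ℕ.+ n) - (g ⊛ g) n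
      g≈ = fix-solves (rootStep-guarded f) (suc n)

    sqrt-unique : ∀ f (f₀ : f 0 ≈ 1#) {s} → s 0 ≈ 1# → s ⊛ s ≋ f → s ≋ sqrt f f₀
    sqrt-unique f f₀ {s} s₀ s²≈f zero    = s₀
    sqrt-unique f f₀ {s} s₀ s²≈f (suc n) = fix-unique (rootStep-guarded f) step n
      where
      half-double : ∀ a → a ≈ ½ * (a + a)
      half-double a = trans (sym (halve a)) (sym (distribˡ _ _ _))

      step : tail s ≋ rootStep f (tail s)
      step zero    = trans (half-double (s 1)) (*-congˡ (trans (sym (square-1 s s₀)) (s²≈f 1)))
      step (suc n) = trans (half-double (s (2 ℕ.+ n))) (*-congˡ (begin
        a + a                         ≈⟨ +-identityʳ _ ⟨
        a + a + 0#                    ≈⟨ +-congˡ (-‿inverseʳ b) ⟨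
        a + a + (b - b)               ≈⟨ +-assoc _ _ _ ⟨
        a + a + b - b                 ≈⟨ +-congʳ (square-suc-suc s s₀ n) ⟨
        (s ⊛ s) (2 ℕ.+ n) - b         ≈⟨ +-congʳ (s²≈f (2 ℕ.+ n)) ⟩
        f (2 ℕ.+ n) - b               ∎))
        where
        a = s (2 ℕ.+ n)
        b = (tail s ⊛ tail s) n

noZeroDivisors⇒cancel : ∀ {c ℓ} (A : CommutativeRing c ℓ) → let open CommutativeRing A in
  (∀ a b → ¬ a ≈ 0# → a * b ≈ 0# → b ≈ 0#) → AlmostLeftCancellative _≈_ 0# _*_
noZeroDivisors⇒cancel A noZeroDivisors a b c a≉0 ab≈ac = x∙y⁻¹≈ε⇒x≈y b c
  (noZeroDivisors a (b - c) a≉0 (trans (x[y-z]≈xy-xz a b c) (trans (+-congʳ ab≈ac) (-‿inverseʳ (a * c)))))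
  where
  open CommutativeRing A
  open RingProperties ring

-- A polynomial is a series with finite support; equality ignores the
-- chosen bound on the degree.
module Polynomials {c ℓ} (R : CommutativeRing c ℓ) where

  open CommutativeRing R
  open PowerSeries R
  open RingProperties ring

  record Polynomial : Set (c ⊔ ℓ) where
    no-eta-equality
    field
      coefficient : Series
      bound       : ℕ
      vanishes    : ∀ {n} → bound ℕ.≤ n → coefficient n ≈ 0#

  open Polynomial public

  infix 4 _≈ᵖ_

  record _≈ᵖ_ (p r : Polynomial) : Set ℓ where
    constructor coefficientwise
    field
      at : coefficient p ≋ coefficient r

  open _≈ᵖ_ public

  private
    ⊛-vanishes : ∀ a b {f g} → (∀ {n} → a ℕ.≤ n → f n ≈ 0#) → (∀ {n} → b ℕ.≤ n → g n ≈ 0#) →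
                 ∀ {n} → a ℕ.+ b ℕ.≤ n → (f ⊛ g) n ≈ 0#
    ⊛-vanishes zero    b {f} {g} f₀ g₀ _ = ⊛-zeroˡ {f} (λ _ → f₀ z≤n) g _
    ⊛-vanishes (suc a) b {f} {g} f₀ g₀ (s≤s a+b≤n) = trans
      (+-cong (trans (*-congˡ (g₀ (ℕ.m≤n⇒m≤1+n (ℕ.m+n≤o⇒n≤o a a+b≤n)))) (zeroʳ _))
              (⊛-vanishes a b {tail f} {g} (λ a≤n → f₀ (s≤s a≤n)) g₀ a+b≤n))
      (+-identityˡ _)

  infixl 7 _*ᵖ_
  infixl 6 _+ᵖ_

  _+ᵖ_ : Polynomial → Polynomial → Polynomial
  coefficient (p +ᵖ r) = coefficient p ⊕ coefficient r
  bound       (p +ᵖ r) = bound p ℕ.⊔ bound r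
  vanishes    (p +ᵖ r) b≤n = trans
    (+-cong (vanishes p (ℕ.m⊔n≤o⇒m≤o (bound p) (bound r) b≤n)) (vanishes r (ℕ.m⊔n≤o⇒n≤o (bound p) (bound r) b≤n)))
    (+-identityˡ 0#)

  -ᵖ_ : Polynomial → Polynomial
  coefficient (-ᵖ p) = ⊖ coefficient p
  bound       (-ᵖ p) = bound p
  vanishes    (-ᵖ p) b≤n = trans (-‿cong (vanishes p b≤n)) -0#≈0#

  _*ᵖ_ : Polynomial → Polynomial → Polynomial
  coefficient (p *ᵖ r) = coefficient p ⊛ coefficient r
  bound       (p *ᵖ r) = bound p ℕ.+ bound r
  vanishes    (p *ᵖ r) = ⊛-vanishes (bound p) (bound r) {coefficient p} {coefficient r} (vanishes p) (vanishes r)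

  0ᵖ 1ᵖ : Polynomial
  coefficient 0ᵖ   = 𝟘
  bound       0ᵖ   = 0
  vanishes    0ᵖ _ = refl
  coefficient 1ᵖ         = 𝟙
  bound       1ᵖ         = 1
  vanishes    1ᵖ (s≤s _) = refl

  Xᵖ : Polynomial
  coefficient Xᵖ               = X
  bound       Xᵖ               = 2
  vanishes    Xᵖ (s≤s (s≤s _)) = refl

  polynomialRing : CommutativeRing (c ⊔ ℓ) ℓ
  polynomialRing = record
    { isCommutativeRing = RingMonomorphism.isCommutativeRing coefficient-mono series-isCommutativeRing }
    where
    rawPolynomialRing : RawRing (c ⊔ ℓ) ℓ
    rawPolynomialRing = record
      { Carrier = Polynomial ; _≈_ = _≈ᵖ_ ; _+_ = _+ᵖ_ ; _*_ = _*ᵖ_ ; -_ = -ᵖ_ ; 0# = 0ᵖ ; 1# = 1ᵖ }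

    coefficient-mono : IsRingMonomorphism rawPolynomialRing (CommutativeRing.rawRing seriesRing) coefficient
    coefficient-mono = record
      { isRingHomomorphism = record
        { isSemiringHomomorphism = record
          { isNearSemiringHomomorphism = record
            { +-isMonoidHomomorphism = record
              { isMagmaHomomorphism = record
                { isRelHomomorphism = record { cong = at }
                ; homo              = λ _ _ _ → refl
                }
              ; ε-homo = λ _ → refl
              }
            ; *-homo = λ _ _ _ → refl
            }
          ; 1#-homo = λ _ → refl
          }
        ; -‿homo = λ _ _ → refl
        }
      ; injective = coefficientwise
      }

  module _ (_≟_ : Decidable _≈_) (cancel : AlmostLeftCancellative _≈_ 0# _*_) where

    private
      cancel-0 : ∀ {a b} → ¬ a ≈ 0# → a * b ≈ 0# → b ≈ 0#
      cancel-0 a≉0 ab≈0 = cancel _ _ _ a≉0 (trans ab≈0 (sym (zeroʳ _)))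

      ⊛-cancel-0-leading : ∀ {f} → ¬ f 0 ≈ 0# → ∀ g → f ⊛ g ≋ 𝟘 → g ≋ 𝟘
      ⊛-cancel-0-leading {f} f₀ g fg≈0 zero = cancel-0 f₀ (trans (sym (+-identityʳ _)) (fg≈0 0))
      ⊛-cancel-0-leading {f} f₀ g fg≈0 (suc n) = ⊛-cancel-0-leading {f} f₀ (tail g) shifted n
        where
        shifted : f ⊛ tail g ≋ 𝟘
        shifted m = trans (sym (trans (+-congˡ (trans (*-congˡ (⊛-cancel-0-leading {f} f₀ g fg≈0 0)) (zeroʳ _))) (+-identityʳ _)))
                          (trans (sym (⊛-suc f g m)) (fg≈0 (suc m)))

      ⊛-cancel-0 : ∀ b {f} → (∀ {n} → b ℕ.≤ n → f n ≈ 0#) → ¬ f ≋ 𝟘 → ∀ g → f ⊛ g ≋ 𝟘 → g ≋ 𝟘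
      ⊛-cancel-0 zero    f₀ f≉0 g fg≈0 = ⊥-elim (f≉0 (λ _ → f₀ z≤n))
      ⊛-cancel-0 (suc b) {f} f₀ f≉0 g fg≈0 with f 0 ≟ 0#
      ... | no  f0≉0 = ⊛-cancel-0-leading {f} f0≉0 g fg≈0
      ... | yes f0≈0 = ⊛-cancel-0 b {tail f} (λ b≤n → f₀ (s≤s b≤n)) (λ tail≈0 → f≉0 λ { zero → f0≈0 ; (suc n) → tail≈0 n }) g
        (λ n → trans (sym (trans (+-congʳ (trans (*-congʳ f0≈0) (zeroˡ _))) (+-identityˡ _))) (fg≈0 (suc n)))

    polynomial-cancel : AlmostLeftCancellative _≈ᵖ_ 0ᵖ _*ᵖ_
    polynomial-cancel = noZeroDivisors⇒cancel polynomialRing λ p r p≉0 pr≈0 → coefficientwise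
      (⊛-cancel-0 (bound p) {coefficient p} (vanishes p) (λ p≋0 → p≉0 (coefficientwise p≋0)) (coefficient r) (at pr≈0))

module Fractions {c ℓ} (A : CommutativeRing c ℓ)
  (1≉0 : ¬ CommutativeRing._≈_ A (CommutativeRing.1# A) (CommutativeRing.0# A))
  (cancel : AlmostLeftCancellative (CommutativeRing._≈_ A) (CommutativeRing.0# A) (CommutativeRing._*_ A)) where

  open CommutativeRing A
  open SetoidReasoning setoid
  open RingProperties ring
  open Solver commutativeSemiring using (solve; _:=_; _:+_; _:*_)

  record Fraction : Set (c ⊔ ℓ) where
    no-eta-equality
    field
      num   : Carrier
      den   : Carrier
      den≉0 : ¬ den ≈ 0#

  open Fraction public

  infix 4 _≈ᶠ_

  record _≈ᶠ_ (a b : Fraction) : Set ℓ where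
    constructor cross
    field
      uncross : num a * den b ≈ num b * den a

  open _≈ᶠ_ public

  private
    *-≉0 : ∀ {a b} → ¬ a ≈ 0# → ¬ b ≈ 0# → ¬ a * b ≈ 0#
    *-≉0 a≉0 b≉0 ab≈0 = b≉0 (cancel _ _ _ a≉0 (trans ab≈0 (sym (zeroʳ _))))

  infixl 7 _*ᶠ_
  infixl 6 _+ᶠ_

  _+ᶠ_ : Fraction → Fraction → Fraction
  num   (x +ᶠ y) = num x * den y + num y * den x
  den   (x +ᶠ y) = den x * den y
  den≉0 (x +ᶠ y) = *-≉0 (den≉0 x) (den≉0 y)

  _*ᶠ_ : Fraction → Fraction → Fraction
  num   (x *ᶠ y) = num x * num y
  den   (x *ᶠ y) = den x * den y
  den≉0 (x *ᶠ y) = *-≉0 (den≉0 x) (den≉0 y)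

  -ᶠ_ : Fraction → Fraction
  num   (-ᶠ x) = - num x
  den   (-ᶠ x) = den x
  den≉0 (-ᶠ x) = den≉0 x

  embed : Carrier → Fraction
  num   (embed a) = a
  den   (embed a) = 1#
  den≉0 (embed a) = 1≉0

  0ᶠ 1ᶠ : Fraction
  0ᶠ = embed 0#
  1ᶠ = embed 1#

  private
    ≈ᶠ-trans : ∀ {x y z} → x ≈ᶠ y → y ≈ᶠ z → x ≈ᶠ z
    ≈ᶠ-trans {x} {y} {z} (cross x≈y) (cross y≈z) = cross (cancel (den y) _ _ (den≉0 y) (begin
      den y * (num x * den z) ≈⟨ solve 3 (λ a d f → d :* (a :* f) := (a :* d) :* f) refl (num x) (den y) (den z) ⟩
      num x * den y * den z   ≈⟨ *-congʳ x≈y ⟩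
      num y * den x * den z   ≈⟨ solve 3 (λ c b f → (c :* b) :* f := (c :* f) :* b) refl (num y) (den x) (den z) ⟩
      num y * den z * den x   ≈⟨ *-congʳ y≈z ⟩
      num z * den y * den x   ≈⟨ solve 3 (λ e d b → (e :* d) :* b := d :* (e :* b)) refl (num z) (den y) (den x) ⟩
      den y * (num z * den x) ∎))

    +ᶠ-cong : ∀ {x x′ y y′} → x ≈ᶠ x′ → y ≈ᶠ y′ → x +ᶠ y ≈ᶠ x′ +ᶠ y′
    +ᶠ-cong {x} {x′} {y} {y′} (cross x≈x′) (cross y≈y′) = cross (begin
      (num x * den y + num y * den x) * (den x′ * den y′)
        ≈⟨ expand (num x) (den x) (num y) (den y) (den x′) (den y′) ⟩
      num x * den x′ * (den y * den y′) + num y * den y′ * (den x * den x′)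
        ≈⟨ +-cong (*-cong x≈x′ (*-comm _ _)) (*-cong y≈y′ (*-comm _ _)) ⟩
      num x′ * den x * (den y′ * den y) + num y′ * den y * (den x′ * den x)
        ≈⟨ expand (num x′) (den x′) (num y′) (den y′) (den x) (den y) ⟨
      (num x′ * den y′ + num y′ * den x′) * (den x * den y) ∎)
      where
      expand : ∀ a b c d e f → (a * d + c * b) * (e * f) ≈ a * e * (d * f) + c * f * (b * e)
      expand = solve 6 (λ a b c d e f → (a :* d :+ c :* b) :* (e :* f) := a :* e :* (d :* f) :+ c :* f :* (b :* e)) refl

    *ᶠ-cong : ∀ {x x′ y y′} → x ≈ᶠ x′ → y ≈ᶠ y′ → x *ᶠ y ≈ᶠ x′ *ᶠ y′
    *ᶠ-cong {x} {x′} {y} {y′} (cross x≈x′) (cross y≈y′) = cross (begin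
      num x * num y * (den x′ * den y′)   ≈⟨ shuffle (num x) (num y) (den x′) (den y′) ⟩
      num x * den x′ * (num y * den y′)   ≈⟨ *-cong x≈x′ y≈y′ ⟩
      num x′ * den x * (num y′ * den y)   ≈⟨ shuffle (num x′) (den x) (num y′) (den y) ⟩
      num x′ * num y′ * (den x * den y)   ∎)
      where
      shuffle : ∀ w x y z → w * x * (y * z) ≈ w * y * (x * z)
      shuffle = solve 4 (λ w x y z → w :* x :* (y :* z) := w :* y :* (x :* z)) refl

  fraction-isCommutativeRing : IsCommutativeRing _≈ᶠ_ _+ᶠ_ _*ᶠ_ -ᶠ_ 0ᶠ 1ᶠ
  fraction-isCommutativeRing = record
    { isRing = record
      { +-isAbelianGroup = record
        { isGroup = record
          { isMonoid = record
            { isSemigroup = record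
              { isMagma = record
                { isEquivalence = ≈ᶠ-isEquivalence
                ; ∙-cong = +ᶠ-cong
                }
              ; assoc = +ᶠ-assoc
              }
            ; identity = +ᶠ-identityˡ , λ x → ≈ᶠ-trans (+ᶠ-comm x 0ᶠ) (+ᶠ-identityˡ x)
            }
          ; inverse = -ᶠ-inverseˡ , λ x → ≈ᶠ-trans (+ᶠ-comm x (-ᶠ x)) (-ᶠ-inverseˡ x)
          ; ⁻¹-cong = λ (cross x≈y) → cross
              (trans (sym (-‿distribˡ-* _ _)) (trans (-‿cong x≈y) (-‿distribˡ-* _ _)))
          }
        ; comm = +ᶠ-comm
        }
      ; *-cong     = *ᶠ-cong
      ; *-assoc    = *ᶠ-assoc
      ; *-identity = *ᶠ-identityˡ , λ x → ≈ᶠ-trans (*ᶠ-comm x 1ᶠ) (*ᶠ-identityˡ x)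
      ; distrib    = *ᶠ-distribˡ , λ x y z → ≈ᶠ-trans (*ᶠ-comm (y +ᶠ z) x)
          (≈ᶠ-trans (*ᶠ-distribˡ x y z) (+ᶠ-cong (*ᶠ-comm x y) (*ᶠ-comm x z)))
      }
    ; *-comm = *ᶠ-comm
    }
    where
    ≈ᶠ-isEquivalence : IsEquivalence _≈ᶠ_
    ≈ᶠ-isEquivalence = record { refl = cross refl ; sym = λ (cross eq) → cross (sym eq) ; trans = ≈ᶠ-trans }

    +ᶠ-assoc : ∀ x y z → (x +ᶠ y) +ᶠ z ≈ᶠ x +ᶠ (y +ᶠ z)
    +ᶠ-assoc x y z = cross
      (solve 6 (λ a b c d e f → ((a :* d :+ c :* b) :* f :+ e :* (b :* d)) :* (b :* (d :* f)) :=
        (a :* (d :* f) :+ (c :* f :+ e :* d) :* b) :* (b :* d :* f)) refl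
        (num x) (den x) (num y) (den y) (num z) (den z))

    *ᶠ-assoc : ∀ x y z → (x *ᶠ y) *ᶠ z ≈ᶠ x *ᶠ (y *ᶠ z)
    *ᶠ-assoc x y z = cross (*-cong (*-assoc _ _ _) (sym (*-assoc _ _ _)))

    +ᶠ-comm : ∀ x y → x +ᶠ y ≈ᶠ y +ᶠ x
    +ᶠ-comm x y = cross (*-cong (+-comm _ _) (*-comm _ _))

    *ᶠ-comm : ∀ x y → x *ᶠ y ≈ᶠ y *ᶠ x
    *ᶠ-comm x y = cross (*-cong (*-comm _ _) (*-comm _ _))

    +ᶠ-identityˡ : ∀ x → 0ᶠ +ᶠ x ≈ᶠ x
    +ᶠ-identityˡ x = cross (*-cong
      (trans (+-cong (zeroˡ _) (*-identityʳ _)) (+-identityˡ _)) (sym (*-identityˡ _)))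

    *ᶠ-identityˡ : ∀ x → 1ᶠ *ᶠ x ≈ᶠ x
    *ᶠ-identityˡ x = cross (*-cong (*-identityˡ _) (sym (*-identityˡ _)))

    -ᶠ-inverseˡ : ∀ x → -ᶠ x +ᶠ x ≈ᶠ 0ᶠ
    -ᶠ-inverseˡ x = cross (begin
      (- num x * den x + num x * den x) * 1# ≈⟨ *-identityʳ _ ⟩
      - num x * den x + num x * den x        ≈⟨ +-congʳ (-‿distribˡ-* (num x) (den x)) ⟨
      - (num x * den x) + num x * den x      ≈⟨ -‿inverseˡ _ ⟩
      0#                                     ≈⟨ zeroˡ _ ⟨
      0# * (den x * den x)                   ∎)

    *ᶠ-distribˡ : ∀ x y z → x *ᶠ (y +ᶠ z) ≈ᶠ x *ᶠ y +ᶠ x *ᶠ z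
    *ᶠ-distribˡ x y z = cross
      (solve 6 (λ a b c d e f → a :* (c :* f :+ e :* d) :* (b :* d :* (b :* f)) :=
        (a :* c :* (b :* f) :+ a :* e :* (b :* d)) :* (b :* (d :* f))) refl
        (num x) (den x) (num y) (den y) (num z) (den z))

  fractionField : CommutativeRing (c ⊔ ℓ) ℓ
  fractionField = record { isCommutativeRing = fraction-isCommutativeRing }

  embed-cong : ∀ {a b} → a ≈ b → embed a ≈ᶠ embed b
  embed-cong a≈b = cross (*-congʳ a≈b)

  embed-+ : ∀ a b → embed (a + b) ≈ᶠ embed a +ᶠ embed b
  embed-+ a b = cross (begin
    (a + b) * (1# * 1#)      ≈⟨ *-cong (+-cong (sym (*-identityʳ a)) (sym (*-identityʳ b))) (*-identityʳ 1#) ⟩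
    (a * 1# + b * 1#) * 1#   ∎)

  embed-* : ∀ a b → embed (a * b) ≈ᶠ embed a *ᶠ embed b
  embed-* a b = cross (*-congˡ (*-identityʳ 1#))

  nonzero-invertible : ∀ x → ¬ x ≈ᶠ 0ᶠ → ∃ λ y → x *ᶠ y ≈ᶠ 1ᶠ
  nonzero-invertible x x≉0 = record { num = den x ; den = num x ; den≉0 = num≉0 } , cross (begin
    num x * den x * 1#     ≈⟨ *-identityʳ _ ⟩
    num x * den x          ≈⟨ *-comm _ _ ⟩
    den x * num x          ≈⟨ *-identityˡ _ ⟨
    1# * (den x * num x)   ∎)
    where
    num≉0 : ¬ num x ≈ 0#
    num≉0 num≈0 = x≉0 (cross (trans (*-identityʳ _) (trans num≈0 (sym (zeroˡ _)))))

private
  ℚ-noZeroDivisors : ∀ a b → ¬ a ≡ 0ℚ → a ℚ.* b ≡ 0ℚ → b ≡ 0ℚ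
  ℚ-noZeroDivisors a b a≢0 ab≡0 = begin
    b                          ≡⟨ ℚ.*-identityˡ b ⟨
    1ℚ ℚ.* b                   ≡⟨ ≡.cong (ℚ._* b) (ℚ.*-inverseˡ a) ⟨
    (ℚ.1/ a) ℚ.* a ℚ.* b       ≡⟨ ℚ.*-assoc (ℚ.1/ a) a b ⟩
    (ℚ.1/ a) ℚ.* (a ℚ.* b)     ≡⟨ ≡.cong ((ℚ.1/ a) ℚ.*_) ab≡0 ⟩
    (ℚ.1/ a) ℚ.* 0ℚ            ≡⟨ ℚ.*-zeroʳ (ℚ.1/ a) ⟩
    0ℚ                         ∎
    where
    open ≡.≡-Reasoning
    instance _ = ℚ.≢-nonZero a≢0

module Poly = Polynomials ℚ.+-*-commutativeRing

ℚ[q] : CommutativeRing _ _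
ℚ[q] = Poly.polynomialRing

module ℚ[q] = CommutativeRing ℚ[q]

ℚ[q]-1≉0 : ¬ ℚ[q].1# ℚ[q].≈ ℚ[q].0#
ℚ[q]-1≉0 1≈0 with () ← Poly.at 1≈0 0

ℚ[q]-cancel : AlmostLeftCancellative ℚ[q]._≈_ ℚ[q].0# ℚ[q]._*_
ℚ[q]-cancel = Poly.polynomial-cancel ℚ._≟_ (noZeroDivisors⇒cancel ℚ.+-*-commutativeRing ℚ-noZeroDivisors)

module Frac = Fractions ℚ[q] ℚ[q]-1≉0 ℚ[q]-cancel

ℚ⟨q⟩ : CommutativeRing _ _
ℚ⟨q⟩ = Frac.fractionField

module ℚ⟨q⟩ = CommutativeRing ℚ⟨q⟩

module Ser = PowerSeries ℚ⟨q⟩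

ℚ⟨q⟩⟦x⟧ : CommutativeRing _ _
ℚ⟨q⟩⟦x⟧ = Ser.seriesRing

2-unit : Ser.Unit (ℚ⟨q⟩.1# ℚ⟨q⟩.+ ℚ⟨q⟩.1#)
2-unit = Frac.nonzero-invertible _ 2≉0
  where
  2≉0 : ¬ ℚ⟨q⟩.1# ℚ⟨q⟩.+ ℚ⟨q⟩.1# ℚ⟨q⟩.≈ ℚ⟨q⟩.0#
  2≉0 2≈0 with () ← Poly.at (Frac.uncross 2≈0) 0

open CommutativeRing ℚ⟨q⟩⟦x⟧ public using (_≈_; _+_; _*_; _-_; 1#)
open Mult (CommutativeRing.+-monoid ℚ⟨q⟩⟦x⟧) public using (_×_)
open Ser public using (_/_⟨_⟩)
open Ser.SquareRoot 2-unit public using (sqrt)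

q x : Ser.Series
q = Ser.constant (Frac.embed Poly.Xᵖ)
x = Ser.X

open Exp ℚ[q].semiring using (_^_)

-- The coefficient of xⁿ is the sum of q^JD(T) over the finitely many T
-- with V(T) = n, each listed exactly once by treesOfSize n.
K : PowerSeries.Series ℚ[q]
K n = foldr ℚ[q]._+_ ℚ[q].0# (map (λ T → Poly.Xᵖ ^ JD T) (treesOfSize n))

embed : PowerSeries.Series ℚ[q] → Ser.Series
embed f n = Frac.embed (f n)

radicand₀≈1 : (1# - 4 × q * x) 0 ℚ⟨q⟩.≈ ℚ⟨q⟩.1#
radicand₀≈1 = ℚ⟨q⟩.trans (ℚ⟨q⟩.+-congˡ (ℚ⟨q⟩.trans (ℚ⟨q⟩.-‿cong
  (ℚ⟨q⟩.trans (ℚ⟨q⟩.+-identityʳ _) (ℚ⟨q⟩.zeroʳ ((4 × q) 0)))) -0#≈0#)) (ℚ⟨q⟩.+-identityʳ _)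
  where open RingProperties ℚ⟨q⟩.ring

denominator₀-unit : Ser.Unit ((sqrt (1# - 4 × q * x) radicand₀≈1 - 1# + 2 × q) 0)
denominator₀-unit = Frac.nonzero-invertible _ denominator₀≉0
  where
  denominator₀≉0 : ¬ (sqrt (1# - 4 × q * x) radicand₀≈1 - 1# + 2 × q) 0 ℚ⟨q⟩.≈ ℚ⟨q⟩.0#
  denominator₀≉0 2q≈0 with () ← Poly.at (Frac.uncross 2q≈0) 1

-- Let G be the sum of x^V q^(JD + D) over all trees.  Splitting each tree
-- at the root, the jump distance D(T_L) is charged to the left subtree and
-- D(T) = 1 + D(T_R), so G = 1 + x q G² and K = 1 + x G K.  By the first
-- equation 1 - 2 q x G is a square root of 1 - 4 q x with constant term 1,
-- hence the denominator is 2 q (1 - x G), and 1 - x G is inverse to K by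
-- the second.
module Submission where

open import Defs using (Tree; ·; [_,_]; V; D; JD; enumerate; treesOfSize; module PowerSeries)
open import Algebra.Bundles using (CommutativeRing)
import Algebra.Properties.CommutativeMonoid.Sum as Sum
import Algebra.Properties.Monoid.Mult as Mult
import Algebra.Properties.Ring as RingProperties
import Algebra.Properties.Semiring.Exp as Exp
import Algebra.Solver.Ring.NaturalCoefficients.Default as Solver
open import Data.Fin.Base using (toℕ)
open import Data.List.Base using (List; []; _∷_; _++_; applyUpTo; cartesianProductWith; concat; foldr; map; upTo)
open import Data.List.Properties using (map-cong-local; map-applyUpTo)
import Data.List.Relation.Unary.All.Properties as All
open import Data.Nat.Base as ℕ using (ℕ; zero; suc; _∸_; s≤s)
import Data.Nat.Properties as ℕ
open import Data.Nat.Tactic.RingSolver using (solve-∀)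
open import Function.Base using (_∘_; id)
open import Relation.Binary.PropositionalEquality as ≡ using (_≡_)
import Relation.Binary.Reasoning.Setoid as SetoidReasoning

-- Enumeration of trees with different fuel

-- Both subtrees of a tree with `suc n` internal vertices have at most `n`, so sufficient fuel stays
-- sufficient down the recursion. This reconciles the blocks of `treesOfSize (suc n)`, all listed
-- with fuel `n`, with `treesOfSize i`, which has fuel `i`.
enumerate-stable : ∀ {k l} n → n ℕ.≤ k → n ℕ.≤ l → enumerate k n ≡ enumerate l n
enumerate-stable zero    _         _         = ≡.refl
enumerate-stable (suc n) (s≤s n≤k) (s≤s n≤l) = ≡.cong concat (map-cong-local (All.applyUpTo⁺₁ id (suc n) λ {i} i<1+n →
  ≡.cong₂ (cartesianProductWith [_,_])
    (enumerate-stable i (ℕ.≤-trans (ℕ.≤-pred i<1+n) n≤k) (ℕ.≤-trans (ℕ.≤-pred i<1+n) n≤l))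
    (enumerate-stable (n ∸ i) (ℕ.≤-trans (ℕ.m∸n≤m n i) n≤k) (ℕ.≤-trans (ℕ.m∸n≤m n i) n≤l))))

-- Algebra of the square root and the denominator

module SquareRootAlgebra {c ℓ} (R : CommutativeRing c ℓ)
  (x q G : CommutativeRing.Carrier R) where

  open CommutativeRing R
  open Mult +-monoid using (_×_)
  open RingProperties ring
  open SetoidReasoning setoid
  open Solver commutativeSemiring using (solve; _:=_; _:+_; _:*_; con)

  root : Carrier
  root = 1# - x * (2 × q * G)

  private
    p = x * (2 × q * G)

    root+p≈1 : root + p ≈ 1#
    root+p≈1 = trans (+-assoc 1# (- p) p) (trans (+-congˡ (-‿inverseˡ p)) (+-identityʳ 1#))

  -- The solver handles semirings only, so negation is avoided: `root` enters through
  -- `root + p ≈ 1#`, and `p * p` is added to both sides and cancelled.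
  root-square : G ≈ 1# + x * (q * G * G) → root * root ≈ 1# - 4 × q * x
  root-square G≈ = trans (x≈z//y _ _ _ (+-cancelʳ (p * p) _ _ (begin
    root * root + 4 × q * x + p * p     ≈⟨ +-assoc _ _ _ ⟩
    root * root + (4 × q * x + p * p)   ≈⟨ +-congˡ p-quadratic ⟨
    root * root + (p + p)               ≈⟨ +-congˡ (+-cong 1p 1p) ⟨
    -- Each `1#` becomes `root + p`, which makes the left side complete to a square.
    root * root + (1# * p + 1# * p)     ≈⟨ +-congˡ (+-cong (*-congʳ root+p≈1) (*-congʳ root+p≈1)) ⟨
    root * root + ((root + p) * p + (root + p) * p)
      ≈⟨ solve 2 (λ r p → r :* r :+ ((r :+ p) :* p :+ (r :+ p) :* p) := (r :+ p) :* (r :+ p) :+ p :* p) refl root p ⟩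
    (root + p) * (root + p) + p * p     ≈⟨ +-congʳ (*-cong root+p≈1 root+p≈1) ⟩
    1# * 1# + p * p                     ≈⟨ +-congʳ (*-identityʳ 1#) ⟩
    1# + p * p                          ∎))) refl
    where
    1p : 1# * p ≈ p
    1p = *-identityˡ p

    -- This is the equation for `G` multiplied by `4 q x`.
    p-quadratic : p + p ≈ 4 × q * x + p * p
    p-quadratic = begin
      p + p ≈⟨ +-cong p≈ p≈ ⟩
      x * (2 × q * (1# + x * (q * G * G))) + x * (2 × q * (1# + x * (q * G * G)))
        -- Multiples of `q` are spelled out ending in `con 0`, as `_×_` unfolds; `1#` is passed as
        -- the variable `i`, and the leftover factor is removed next.
        ≈⟨ solve 4 (λ x q G i → x :* ((q :+ (q :+ con 0)) :* (i :+ x :* (q :* G :* G))) :+ x :* ((q :+ (q :+ con 0)) :* (i :+ x :* (q :* G :* G)))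
             := (q :+ (q :+ (q :+ (q :+ con 0)))) :* x :* i
               :+ x :* ((q :+ (q :+ con 0)) :* G) :* (x :* ((q :+ (q :+ con 0)) :* G))) refl x q G 1# ⟩
      4 × q * x * 1# + p * p ≈⟨ +-congʳ (*-identityʳ _) ⟩
      4 × q * x + p * p ∎
      where
      p≈ : p ≈ x * (2 × q * (1# + x * (q * G * G)))
      p≈ = *-congˡ (*-congˡ G≈)

  -- The denominator is `2 q - p = 2 q (1 - x G)`, and the hypothesis says `(1 - x G) K = 1`. Adding
  -- `p * K` to both sides again avoids subtraction.
  root-denominator : ∀ {K} → K ≈ 1# + x * (G * K) → (root - 1# + 2 × q) * K ≈ 2 × q
  root-denominator {K} K≈ = +-cancelʳ (p * K) _ _ (begin
    (root - 1# + 2 × q) * K + p * K       ≈⟨ solve 5 (λ r m Q p K → (r :+ m :+ Q) :* K :+ p :* K := (r :+ p :+ m) :* K :+ Q :* K) refl root (- 1#) (2 × q) p K ⟩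
    (root + p - 1#) * K + 2 × q * K       ≈⟨ +-congʳ (*-congʳ (trans (+-congʳ root+p≈1) (-‿inverseʳ 1#))) ⟩
    0# * K + 2 × q * K                    ≈⟨ trans (+-congʳ (zeroˡ K)) (+-identityˡ _) ⟩
    2 × q * K                             ≈⟨ *-congˡ K≈ ⟩
    2 × q * (1# + x * (G * K))            ≈⟨ distribˡ _ _ _ ⟩
    2 × q * 1# + 2 × q * (x * (G * K))    ≈⟨ +-cong (*-identityʳ _) (solve 4 (λ Q x G K → Q :* (x :* (G :* K)) := x :* (Q :* G) :* K) refl (2 × q) x G K) ⟩
    2 × q + p * K                         ∎)

-- Generating series of weighted trees

module TreeSeries {c ℓ} (R : CommutativeRing c ℓ) where

  open CommutativeRing R
  open PowerSeries R
  open Exp semiring using (_^_; ^-homo-*; ^-congʳ)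
  open Sum +-commutativeMonoid using (sum; sum-cong-≋)
  open SetoidReasoning setoid

  constant-⊛ : ∀ a f n → (constant a ⊛ f) n ≈ a * f n
  constant-⊛ a f zero    = +-identityʳ _
  constant-⊛ a f (suc n) = trans (+-congˡ (⊛-zeroˡ (λ _ → refl) f n)) (+-identityʳ _)

  X-⊛-zero : ∀ f → (X ⊛ f) 0 ≈ 0#
  X-⊛-zero f = trans (+-identityʳ _) (zeroˡ _)

  X-⊛-suc : ∀ f n → (X ⊛ f) (suc n) ≈ f n
  X-⊛-suc f n = trans (+-cong (zeroˡ _) (⊛-identityˡ f n)) (+-identityˡ _)

  total : (Tree → Carrier) → List Tree → Carrier
  total w ts = foldr _+_ 0# (map w ts)

  total-++ : ∀ w ts us → total w (ts ++ us) ≈ total w ts + total w us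
  total-++ w []       us = sym (+-identityˡ _)
  total-++ w (t ∷ ts) us = trans (+-congˡ (total-++ w ts us)) (sym (+-assoc _ _ _))

  total-scale : ∀ a w ts → total (λ T → a * w T) ts ≈ a * total w ts
  total-scale a w []       = sym (zeroʳ a)
  total-scale a w (t ∷ ts) = trans (+-congˡ (total-scale a w ts)) (sym (distribˡ _ _ _))

  total-concat-applyUpTo : ∀ w f n → total w (concat (applyUpTo f n)) ≈ sum {n} (λ i → total w (f (toℕ i)))
  total-concat-applyUpTo w f zero    = refl
  total-concat-applyUpTo w f (suc n) =
    trans (total-++ w (f 0) _) (+-congˡ (total-concat-applyUpTo w (f ∘ suc) n))

  series : (Tree → Carrier) → Series
  series w n = total w (treesOfSize n)

  module _ {w a b : Tree → Carrier} (split : ∀ L R → w [ L , R ] ≈ a L * b R) where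

    total-map : ∀ L ts → total w (map [ L ,_] ts) ≈ a L * total b ts
    total-map L []       = sym (zeroʳ _)
    total-map L (t ∷ ts) = trans (+-cong (split L t) (total-map L ts)) (sym (distribˡ _ _ _))

    total-product : ∀ ts us → total w (cartesianProductWith [_,_] ts us) ≈ total a ts * total b us
    total-product []       us = sym (zeroˡ _)
    total-product (t ∷ ts) us = trans (total-++ w (map [ t ,_] us) _)
      (trans (+-cong (total-map t us) (total-product ts us)) (sym (distribʳ _ _ _)))

    -- A weight that factors over the root turns the split into left size `i` and right size `n ∸ i`
    -- into a convolution; `X` accounts for the root. Different weights for the two sides let the
    -- left one absorb `D L`.
    series-split : series w ≋ constant (w ·) ⊕ X ⊛ (series a ⊛ series b)
    series-split zero    = +-congˡ (sym (X-⊛-zero (series a ⊛ series b)))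
    series-split (suc n) = begin
      total w (concat (map block (upTo (suc n))))
        ≡⟨ ≡.cong (total w ∘ concat) (map-applyUpTo id block (suc n)) ⟩
      total w (concat (applyUpTo block (suc n)))
        ≈⟨ total-concat-applyUpTo w block (suc n) ⟩
      sum {suc n} (λ i → total w (block (toℕ i)))
        ≈⟨ sum-cong-≋ {suc n} (λ i → total-product (enumerate n (toℕ i)) (enumerate n (n ∸ toℕ i))) ⟩
      ((λ i → total a (enumerate n i)) ⊛ (λ i → total b (enumerate n i))) n
        -- Coefficient `n` of the product involves only sizes up to `n`, for which fuel `n`
        -- suffices.
        ≈⟨ ⊛-cong-≤ n (λ {m} m≤n → reflexive (≡.cong (total a) (enumerate-stable m m≤n ℕ.≤-refl)))
                      (λ {m} m≤n → reflexive (≡.cong (total b) (enumerate-stable m m≤n ℕ.≤-refl))) ⟩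
      (series a ⊛ series b) n
        ≈⟨ X-⊛-suc (series a ⊛ series b) n ⟨
      (X ⊛ (series a ⊛ series b)) (suc n)
        ≈⟨ +-identityˡ _ ⟨
      0# + (X ⊛ (series a ⊛ series b)) (suc n) ∎
      where
      block : ℕ → List Tree
      block i = cartesianProductWith [_,_] (enumerate n i) (enumerate n (n ∸ i))

  module _ (t : Carrier) where

    jump jumpDepth : Tree → Carrier
    jump      T = t ^ JD T
    jumpDepth T = t ^ (JD T ℕ.+ D T)

    jump-equation : series jump ≋ 𝟙 ⊕ X ⊛ (series jumpDepth ⊛ series jump)
    jump-equation = series-split λ L R →
      trans (^-congʳ t (reorder (JD L) (JD R) (D L))) (^-homo-* t (JD L ℕ.+ D L) (JD R))
      where
      reorder : ∀ i j k → i ℕ.+ j ℕ.+ k ≡ i ℕ.+ k ℕ.+ j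
      reorder = solve-∀

    jumpDepth-equation : series jumpDepth ≋ 𝟙 ⊕ X ⊛ (constant t ⊛ series jumpDepth ⊛ series jumpDepth)
    jumpDepth-equation n = trans
      (series-split {a = λ T → t * jumpDepth T} {b = jumpDepth} (λ L R →
        trans (^-congʳ t (reorder (JD L) (JD R) (D L) (D R)))
              -- The exponent starts with `suc` so that its power computes to `t * jumpDepth L`: the
              -- 1 in `D [ L , R ]` is charged to the left factor.
              (^-homo-* t (suc (JD L ℕ.+ D L)) (JD R ℕ.+ D R))) n)
      (+-congˡ (⊛-cong {X} (λ _ → refl) (⊛-cong {g = series jumpDepth} (λ m →
        trans (total-scale t jumpDepth (treesOfSize m)) (sym (constant-⊛ t (series jumpDepth) m))) (λ _ → refl)) n))
      where
      reorder : ∀ i j k l → i ℕ.+ j ℕ.+ k ℕ.+ (1 ℕ.+ l) ≡ 1 ℕ.+ (i ℕ.+ k) ℕ.+ (j ℕ.+ l)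
      reorder = solve-∀

-- Closed form over a ring in which 2 is invertible

module ClosedForm {c ℓ} (R : CommutativeRing c ℓ) (t : CommutativeRing.Carrier R)
  (2-unit : PowerSeries.Unit R (CommutativeRing._+_ R (CommutativeRing.1# R) (CommutativeRing.1# R))) where

  private
    module R = CommutativeRing R
    module Ser = PowerSeries R
  open TreeSeries R
  open CommutativeRing Ser.seriesRing
  open Mult +-monoid using (_×_)
  open Ser using (_/_⟨_⟩)
  open Ser.SquareRoot 2-unit using (sqrt; sqrt-unique)
  open SetoidReasoning setoid

  private
    q x J G : Ser.Series
    q = Ser.constant t
    x = Ser.X
    J = series (jump t)
    G = series (jumpDepth t)

  open SquareRootAlgebra Ser.seriesRing x q G

  root₀≈1 : root 0 R.≈ R.1#
  root₀≈1 = R.trans (R.+-congˡ (R.trans (R.-‿cong (X-⊛-zero (2 × q * G)))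
    (RingProperties.-0#≈0# R.ring))) (R.+-identityʳ R.1#)

  -- Multiplying `d * J ≈ 2 × q` by the inverse of `d` gives the quotient. The proofs `f₀` and `d₀`
  -- are arbitrary, so those fixed in the theorem can be supplied.
  jump-closed-form : (f₀ : (1# - 4 × q * x) 0 R.≈ R.1#) (d₀ : Ser.Unit ((sqrt (1# - 4 × q * x) f₀ - 1# + 2 × q) 0)) →
    J ≈ (2 × q) / (sqrt (1# - 4 × q * x) f₀ - 1# + 2 × q) ⟨ d₀ ⟩
  jump-closed-form f₀ d₀ = begin
    J               ≈⟨ *-identityʳ J ⟨
    J * 1#          ≈⟨ *-congˡ {J} (Ser.⊛-inverse d d₀) ⟨
    J * (d * d⁻¹)   ≈⟨ *-assoc J d d⁻¹ ⟨
    J * d * d⁻¹     ≈⟨ *-congʳ {d⁻¹} (trans {J * d} {d * J} {2 × q} (*-comm J d) d*J≈2q) ⟩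
    2 × q * d⁻¹     ∎
    where
    s d d⁻¹ : Ser.Series
    s   = sqrt (1# - 4 × q * x) f₀
    d   = s - 1# + 2 × q
    d⁻¹ = Ser.inverse d d₀

    root≈s : root ≈ s
    -- The constant term 1 of `root` excludes the other sign of the square root.
    root≈s = sqrt-unique (1# - 4 × q * x) f₀ root₀≈1 (root-square (jumpDepth-equation t))

    d*J≈2q : d * J ≈ 2 × q
    d*J≈2q = trans {d * J} {(root - 1# + 2 × q) * J} {2 × q}
      (*-congʳ {J} {d} {root - 1# + 2 × q} λ n → R.+-congʳ (R.+-congʳ (R.sym (root≈s n))))
      (root-denominator (jump-equation t))

-- Passage from polynomial coefficients to rational functions

open import Defs

private
  t : ℚ⟨q⟩.Carrier
  t = Frac.embed Poly.Xᵖ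

embed-^ : ∀ p n → Frac.embed (Exp._^_ ℚ[q].semiring p n) ℚ⟨q⟩.≈ Exp._^_ ℚ⟨q⟩.semiring (Frac.embed p) n
embed-^ p zero    = ℚ⟨q⟩.refl
embed-^ p (suc n) = ℚ⟨q⟩.trans (Frac.embed-* p (Exp._^_ ℚ[q].semiring p n)) (ℚ⟨q⟩.*-congˡ (embed-^ p n))

-- `K` has coefficients in `ℚ[q]`, but the constant term `2 q` of the denominator is a unit only in
-- `ℚ⟨q⟩`. Since `Frac.embed` respects sums and powers, the coefficients can be compared there.
embed-total : ∀ ts → Frac.embed (TreeSeries.total ℚ[q] (TreeSeries.jump ℚ[q] Poly.Xᵖ) ts) ℚ⟨q⟩.≈
                     TreeSeries.total ℚ⟨q⟩ (TreeSeries.jump ℚ⟨q⟩ t) ts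
embed-total []       = ℚ⟨q⟩.refl
embed-total (T ∷ ts) = ℚ⟨q⟩.trans (Frac.embed-+ _ _) (ℚ⟨q⟩.+-cong (embed-^ Poly.Xᵖ (JD T)) (embed-total ts))

theorem6 : embed K ≈ (2 × q) / (sqrt (1# - 4 × q * x) radicand₀≈1 - 1# + 2 × q) ⟨ denominator₀-unit ⟩
theorem6 n = ℚ⟨q⟩.trans (embed-total (treesOfSize n))
  (ClosedForm.jump-closed-form ℚ⟨q⟩ t 2-unit radicand₀≈1 denominator₀-unit n)
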